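{- Let $n\ge 1$ be an integer. If the $4n$ vertices of the graph $K_4\times P_n$ are colored uniformly and independently with two colors, the expected number of blocks is $$\mathbb{E}[X_2(K_{4}\times P_n)]=\frac{2^{4 n-7}(175 + 65 n)}{2^{4n}}.$$
   Context: $K_m$ is the complete graph on $m$ vertices and $P_n$ the path graph on $n$ vertices. The product $G_1\times G_2$ of graphs $G_1=(V_1,E_1)$, $G_2=(V_2,E_2)$ is the Cartesian product: its vertex set is $V_1\times V_2$, and $(v_1,v_2),(w_1,w_2)$ are adjacent iff ($v_1=w_1$ and $\{v_2,w_2\}\in E_2$) or ($v_2=w_2$ and $\{v_1,w_1\}\in E_1$). Given a coloring of the vertices of a finite graph $G$ with $k$ colors, the blocks are the connected components of the subgraph of $G$ formed by all vertices and all edges whose two endpoints have the same color. $X_k(G)$ denotes the number of blocks when each vertex of $G$ receives independently a uniformly random color among $k$ colors. -}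

module Defs where

open import Data.Nat as ℕ using (ℕ; zero; suc)
import Data.Nat.Properties as ℕ
open import Data.Integer using (ℤ; +_; -[1+_])
open import Data.Rational using (ℚ; _/_; NonZero)
open import Data.Rational.Properties using (normalize-pos; pos⇒nonZero)
open import Data.Fin using (Fin; toℕ; punchIn; punchOut)
import Data.Fin.Properties as Fin
open import Data.Nat.ListAction using (sum)
open import Data.Vec as Vec using (Vec)
open import Data.List using (List; []; _∷_; map; allFin; cartesianProduct; cartesianProductWith)
open import Data.List.Membership.Propositional using (_∈_)
open import Data.List.Membership.Propositional.Properties using (∈-map⁺; ∈-allFin; ∈-cartesianProduct⁺)
open import Data.List.Relation.Unary.All as All using (All; []; _∷_)
open import Data.Product using (∃; _×_; _,_; proj₁)
open import Data.Product.Algebra using (×-comm)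
open import Data.Product.Function.NonDependent.Propositional using (_×-↔_)
open import Data.Sum using (_⊎_; inj₁; inj₂; swap)
open import Function using (_∘_; _↔_; Inverse)
open import Function.Construct.Composition using (_↔-∘_)
open import Function.Construct.Identity using (↔-id)
open import Level using (0ℓ)
open import Relation.Binary using (Setoid; Decidable; DecidableEquality; Symmetric; Irreflexive)
open import Relation.Binary.Construct.Closure.ReflexiveTransitive using (Star; ε; _◅_; _◅◅_; reverse)
open import Relation.Binary.PropositionalEquality using (_≡_; _≢_; refl; sym; trans; cong; subst; setoid; ≢-sym)
open import Relation.Nullary using (yes; no; contradiction)
open import Relation.Nullary.Decidable using (map′; ¬?; _×-dec_; _⊎-dec_)

record FiniteGraph : Set₁ where
  infix 4 _~_ _~?_
  field
    V        : Set
    order    : ℕ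
    enum     : Fin order ↔ V
    _~_      : V → V → Set
    _~?_     : Decidable _~_
    ~-sym    : Symmetric _~_
    ~-irrefl : Irreflexive _≡_ _~_

  index : V → Fin order
  index = Inverse.from enum

  vertex : Fin order → V
  vertex = Inverse.to enum

  vertex-index : ∀ v → vertex (index v) ≡ v
  vertex-index = Inverse.strictlyInverseˡ enum

  index-vertex : ∀ i → index (vertex i) ≡ i
  index-vertex = Inverse.strictlyInverseʳ enum

  index-injective : ∀ {u v} → index u ≡ index v → u ≡ v
  index-injective {u} {v} eq = trans (sym (vertex-index u)) (trans (cong vertex eq) (vertex-index v))

  _≟_ : DecidableEquality V
  u ≟ v = map′ index-injective (cong index) (index u Fin.≟ index v)

  Connected : V → V → Set
  Connected = Star _~_

  -- The quotient of V by Connected: its elements, up to ≈, are the connected components.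
  Components : Setoid 0ℓ 0ℓ
  Components = record
    { Carrier       = V
    ; _≈_           = Connected
    ; isEquivalence = record { refl = ε ; sym = reverse ~-sym ; trans = _◅◅_ }
    }

K : ℕ → FiniteGraph
K m = record
  { V        = Fin m
  ; order    = m
  ; enum     = ↔-id (Fin m)
  ; _~_      = _≢_
  ; _~?_     = λ i j → ¬? (i Fin.≟ j)
  ; ~-sym    = ≢-sym
  ; ~-irrefl = λ i≡j i≢j → i≢j i≡j
  }

P : ℕ → FiniteGraph
P n = record
  { V        = Fin n
  ; order    = n
  ; enum     = ↔-id (Fin n)
  ; _~_      = λ i j → toℕ j ≡ suc (toℕ i) ⊎ toℕ i ≡ suc (toℕ j)
  ; _~?_     = λ i j → (toℕ j ℕ.≟ suc (toℕ i)) ⊎-dec (toℕ i ℕ.≟ suc (toℕ j))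
  ; ~-sym    = swap
  ; ~-irrefl = λ where
      refl (inj₁ eq) → ℕ.1+n≢n (sym eq)
      refl (inj₂ eq) → ℕ.1+n≢n (sym eq)
  }

infixr 7 _□_

-- Cartesian product; its vertices are listed one copy of G₁ after another.
_□_ : FiniteGraph → FiniteGraph → FiniteGraph
G₁ □ G₂ = record
  { V        = G₁.V × G₂.V
  ; order    = G₂.order ℕ.* G₁.order
  ; enum     = ×-comm G₂.V G₁.V ↔-∘ ((G₂.enum ×-↔ G₁.enum) ↔-∘ Fin.*↔×)
  ; _~_      = λ (v₁ , v₂) (w₁ , w₂) → (v₁ ≡ w₁ × v₂ G₂.~ w₂) ⊎ (v₂ ≡ w₂ × v₁ G₁.~ w₁)
  ; _~?_     = λ (v₁ , v₂) (w₁ , w₂) →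
      ((v₁ G₁.≟ w₁) ×-dec (v₂ G₂.~? w₂)) ⊎-dec ((v₂ G₂.≟ w₂) ×-dec (v₁ G₁.~? w₁))
  ; ~-sym    = λ where
      (inj₁ (eq , e)) → inj₁ (sym eq , G₂.~-sym e)
      (inj₂ (eq , e)) → inj₂ (sym eq , G₁.~-sym e)
  ; ~-irrefl = λ where
      refl (inj₁ (_ , e)) → G₂.~-irrefl refl e
      refl (inj₂ (_ , e)) → G₁.~-irrefl refl e
  }
  where
  module G₁ = FiniteGraph G₁
  module G₂ = FiniteGraph G₂

-- Finiteness of the set of components: start from the discrete labelling and,
-- for each edge in turn, merge the labels of its endpoints.
module _ (G : FiniteGraph) where
  open FiniteGraph G

  private
    record Labelling (pairs : List (V × V)) : Set where
      field
        size      : ℕ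
        label     : V → Fin size
        rep       : Fin size → V
        label-rep : ∀ i → label (rep i) ≡ i
        sound     : ∀ {u v} → label u ≡ label v → Connected u v
        complete  : All (λ (u , v) → u ~ v → label u ≡ label v) pairs

    module _ {m} {i j : Fin (suc m)} (j≢i : j ≢ i) where
      merge : Fin (suc m) → Fin m
      merge x with j Fin.≟ x
      ... | yes _   = punchOut j≢i
      ... | no  j≢x = punchOut j≢x

      merge-i≡j : merge i ≡ merge j
      merge-i≡j with j Fin.≟ i | j Fin.≟ j
      ... | yes j≡i | _       = contradiction j≡i j≢i
      ... | no  _   | yes _   = Fin.punchOut-cong j refl
      ... | no  _   | no  j≢j = contradiction refl j≢j

      merge-punchIn : ∀ k → merge (punchIn j k) ≡ k
      merge-punchIn k with j Fin.≟ punchIn j k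
      ... | yes eq = contradiction (sym eq) (Fin.punchInᵢ≢i j k)
      ... | no  _  = trans (Fin.punchOut-cong j refl) (Fin.punchOut-punchIn j)

      merge-reflects : ∀ x y → merge x ≡ merge y → x ≡ y ⊎ (x ≡ i × y ≡ j) ⊎ (x ≡ j × y ≡ i)
      merge-reflects x y eq with j Fin.≟ x | j Fin.≟ y
      ... | yes j≡x | yes j≡y = inj₁ (trans (sym j≡x) j≡y)
      ... | yes j≡x | no  j≢y = inj₂ (inj₂ (sym j≡x , sym (Fin.punchOut-injective j≢i j≢y eq)))
      ... | no  j≢x | yes j≡y = inj₂ (inj₁ (Fin.punchOut-injective j≢x j≢i eq , sym j≡y))
      ... | no  j≢x | no  j≢y = inj₁ (Fin.punchOut-injective j≢x j≢y eq)

    discrete : Labelling []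
    discrete = record
      { size      = order
      ; label     = index
      ; rep       = vertex
      ; label-rep = index-vertex
      ; sound     = λ {u} eq → subst (Connected u) (index-injective eq) ε
      ; complete  = []
      }

    identify : ∀ {m pairs} {a b : V} (label : V → Fin m) (rep : Fin m → V) →
               (∀ i → label (rep i) ≡ i) →
               (∀ {u v} → label u ≡ label v → Connected u v) →
               All (λ (u , v) → u ~ v → label u ≡ label v) pairs →
               a ~ b → label b ≢ label a → Labelling ((a , b) ∷ pairs)
    identify {zero} {a = a} label _ _ _ _ _ _ = contradiction (label a) Fin.¬Fin0
    identify {suc m} {a = a} {b} label rep label-rep sound complete a~b b≢a = record
      { size      = m
      ; label     = merge b≢a ∘ label
      ; rep       = rep ∘ punchIn (label b)
      ; label-rep = λ k → trans (cong (merge b≢a) (label-rep _)) (merge-punchIn b≢a k)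
      ; sound     = λ {u} {v} eq → sound′ (merge-reflects b≢a (label u) (label v) eq)
      ; complete  = (λ _ → merge-i≡j b≢a) ∷ All.map (λ f e → cong (merge b≢a) (f e)) complete
      }
      where
      sound′ : ∀ {u v} → label u ≡ label v ⊎ (label u ≡ label a × label v ≡ label b)
                                            ⊎ (label u ≡ label b × label v ≡ label a) → Connected u v
      sound′ (inj₁ eq)              = sound eq
      sound′ (inj₂ (inj₁ (ua , vb))) = sound ua ◅◅ a~b ◅ sound (sym vb)
      sound′ (inj₂ (inj₂ (ub , va))) = sound ub ◅◅ ~-sym a~b ◅ sound (sym va)

    labelling : ∀ pairs → Labelling pairs
    labelling [] = discrete
    labelling ((a , b) ∷ pairs) with labelling pairs
    ... | l with a ~? b
    ...   | no  a≁b = record { Labelling l ; complete = (λ e → contradiction e a≁b) ∷ Labelling.complete l }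
    ...   | yes a~b with Labelling.label l b Fin.≟ Labelling.label l a
    ...     | yes eq  = record { Labelling l ; complete = (λ _ → sym eq) ∷ Labelling.complete l }
    ...     | no  b≢a = let open Labelling l in identify label rep label-rep sound complete a~b b≢a

    vertices : List V
    vertices = map vertex (allFin order)

    ∈-vertices : ∀ v → v ∈ vertices
    ∈-vertices v = subst (_∈ vertices) (vertex-index v) (∈-map⁺ vertex (∈-allFin (index v)))

  components-finite : ∃ λ m → Inverse Components (setoid (Fin m))
  components-finite = size , record
    { to        = label
    ; from      = rep
    ; to-cong   = connected⇒≡
    ; from-cong = λ { refl → ε }
    ; inverse   = (λ {i} p → trans (connected⇒≡ p) (label-rep i))
                , (λ { refl → sound (label-rep _) })
    }
    where
    open Labelling (labelling (cartesianProduct vertices vertices))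
    connected⇒≡ : ∀ {u v} → Connected u v → label u ≡ label v
    connected⇒≡ ε = refl
    connected⇒≡ (e ◅ p) =
      trans (All.lookup complete (∈-cartesianProduct⁺ (∈-vertices _) (∈-vertices _)) e) (connected⇒≡ p)

  numComponents : ℕ
  numComponents = proj₁ components-finite

Coloring : ℕ → FiniteGraph → Set
Coloring k G = FiniteGraph.V G → Fin k

monochromatic : ∀ {k} (G : FiniteGraph) → Coloring k G → FiniteGraph
monochromatic G c = record
  { V        = V
  ; order    = order
  ; enum     = enum
  ; _~_      = λ u v → u ~ v × c u ≡ c v
  ; _~?_     = λ u v → (u ~? v) ×-dec (c u Fin.≟ c v)
  ; ~-sym    = λ (e , eq) → ~-sym e , sym eq
  ; ~-irrefl = λ u≡v (e , _) → ~-irrefl u≡v e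
  }
  where open FiniteGraph G

X : (k : ℕ) (G : FiniteGraph) → Coloring k G → ℕ
X k G c = numComponents (monochromatic G c)

words : (k n : ℕ) → List (Vec (Fin k) n)
words k zero    = Vec.[] ∷ []
words k (suc n) = cartesianProductWith Vec._∷_ (allFin k) (words k n)

-- Every coloring, exactly once (up to pointwise equality).
colorings : (k : ℕ) (G : FiniteGraph) → List (Coloring k G)
colorings k G = map (λ w v → Vec.lookup w (FiniteGraph.index G v)) (words k (FiniteGraph.order G))

-- Independent uniform colors on the vertices amount to the uniform distribution
-- on the k ^ order colorings.
𝔼 : (k : ℕ) .{{_ : ℕ.NonZero k}} (G : FiniteGraph) → (Coloring k G → ℕ) → ℚ
𝔼 k G f = _/_ (+ sum (map f (colorings k G))) (k ℕ.^ order) {{ℕ.m^n≢0 k order}}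
  where open FiniteGraph G using (order)

infix 8 2^_

2^_ : ℤ → ℚ
2^ (+ n)    = + (2 ℕ.^ n) / 1
2^ -[1+ n ] = _/_ (+ 1) (2 ℕ.^ suc n) {{ℕ.m^n≢0 2 (suc n)}}

2^-nonZero : ∀ z → NonZero (2^ z)
2^-nonZero z@(+ n)      = pos⇒nonZero (2^ z) {{normalize-pos (2 ℕ.^ n) 1 {{_}} {{ℕ.m^n≢0 2 n}}}}
2^-nonZero z@(-[1+ n ]) = pos⇒nonZero (2^ z) {{normalize-pos 1 (2 ℕ.^ suc n) {{ℕ.m^n≢0 2 (suc n)}}}}

{-# OPTIONS --safe #-}
module Submission where

-- Within one copy of K m two vertices of the same color are adjacent, so the
-- blocks arise by gluing color classes of single rows, and a class of row i is
-- glued to the class of the same color in row i + 1 exactly when some column has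
-- that color in both rows.  For each color this gluing pattern is a subgraph of a
-- path, hence every block has a unique class in its lowest row.  Counting blocks
-- therefore means counting the classes not glued to the previous row: the count
-- is a sum over pairs of consecutive rows, which can be summed over colorings
-- term by term.  For m = 4 and two colors, a row has 30 classes in total over the
-- 16 colorings, and a pair of rows has 130 unglued classes over the 256 colorings.

open import Defs
open import Data.Nat using (ℕ; _≤_)
import Data.Nat as ℕ
open import Data.Integer using (+_; _-_)
open import Data.Rational using (_/_; _*_; _÷_)
open import Relation.Binary.PropositionalEquality using (_≡_)

open import Data.Nat using (zero; suc)
import Data.Nat.Properties as ℕ
open import Data.Nat.ListAction using (sum)
open import Data.Nat.ListAction.Properties using (sum-++)
open import Data.Nat.Solver using (module +-*-Solver)
import Data.Integer as ℤ
import Data.Integer.Properties as ℤ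
import Data.Rational as ℚ
import Data.Rational.Properties as ℚ
open import Data.Rational.Unnormalised as ℚᵘ using (mkℚᵘ; *≡*)
import Data.Rational.Unnormalised.Properties as ℚᵘ
open import Data.Fin as Fin using (Fin; zero; suc; toℕ; inject₁; combine)
import Data.Fin.Properties as Fin
open import Data.Fin.Induction using (<-wellFounded; Acc; acc)
open import Data.Vec as Vec using (Vec)
import Data.Vec.Properties as Vec
open import Data.List using (List; []; _∷_; _++_; map; length; lookup; filter; allFin; cartesianProductWith)
open import Data.List.Properties using (length-++; map-++; map-∘; map-cong; map-tabulate; filter-++; filter-≐; length-tabulate)
open import Data.List.Membership.Propositional using (_∈_)
open import Data.List.Membership.Propositional.Properties using (∈-lookup; ∈-filter⁺; ∈-filter⁻; ∈-allFin; ∈-cartesianProductWith⁺)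
import Data.List.Relation.Unary.All as All
open import Data.List.Relation.Unary.AllPairs using (_∷_)
import Data.List.Relation.Unary.Any as Any
open import Data.List.Relation.Unary.Any.Properties using (lookup-index)
open import Data.List.Relation.Unary.Unique.Propositional using (Unique)
import Data.List.Relation.Unary.Unique.Propositional.Properties as Unique
open import Data.Product using (∃; _×_; _,_; proj₁; proj₂)
open import Data.Sum using (_⊎_; inj₁; inj₂)
open import Function using (_∘_; id; Inverse)
open import Relation.Binary using (Setoid; tri<; tri≈; tri>)
open import Relation.Binary.Construct.Closure.ReflexiveTransitive using (ε; _◅_; _◅◅_)
open import Relation.Binary.PropositionalEquality using (_≗_; refl; sym; trans; cong; cong₂; subst; module ≡-Reasoning)
open import Relation.Nullary using (¬_; yes; no; contradiction)
open import Relation.Nullary.Decidable using (¬?; _×-dec_; _→-dec_)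
import Relation.Unary as U

-- Counting components through a list of representatives

lookup-injective : ∀ {A : Set} {xs : List A} → Unique xs →
                   ∀ {i j} → lookup xs i ≡ lookup xs j → i ≡ j
lookup-injective (_ ∷ _)   {zero}  {zero}  _  = refl
lookup-injective (x∉ ∷ _)  {zero}  {suc j} eq = contradiction eq (All.lookup x∉ (∈-lookup j))
lookup-injective (x∉ ∷ _)  {suc i} {zero}  eq = contradiction (sym eq) (All.lookup x∉ (∈-lookup i))
lookup-injective (_ ∷ xs!) {suc i} {suc j} eq = cong suc (lookup-injective xs! eq)

module _ (G : FiniteGraph) where
  open FiniteGraph G

  -- Reduces the computed component count to a list length, using only the bijection with the
  -- quotient and nothing about the merging procedure. Each component is sent to the position of a
  -- listed vertex it contains, and each position to the component of its entry; both maps are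
  -- injective, so the two finite sizes bound each other.
  numComponents-transversal : ∀ {xs} → Unique xs →
    (∀ v → ∃ λ u → u ∈ xs × Connected v u) →
    (∀ {u v} → u ∈ xs → v ∈ xs → Connected u v → u ≡ v) →
    numComponents G ≡ length xs
  numComponents-transversal {xs} xs! meets separated = ℕ.≤-antisym
    (Fin.injective⇒≤ {f = position} position-injective)
    (Fin.injective⇒≤ {f = to ∘ lookup xs} component-injective)
    where
    open Inverse (proj₂ (components-finite G)) using (to; from; to-cong; strictlyInverseˡ; strictlyInverseʳ)

    connected : ∀ {u v} → to u ≡ to v → Connected u v
    connected {u} {v} eq = Setoid.sym Components (strictlyInverseʳ u) ◅◅
      subst (λ i → Connected (from i) v) (sym eq) (strictlyInverseʳ v)

    component-injective : ∀ {i j} → to (lookup xs i) ≡ to (lookup xs j) → i ≡ j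
    component-injective eq = lookup-injective xs! (separated (∈-lookup _) (∈-lookup _) (connected eq))

    position : Fin (numComponents G) → Fin (length xs)
    position i = Any.index (proj₁ (proj₂ (meets (from i))))

    position-injective : ∀ {i j} → position i ≡ position j → i ≡ j
    position-injective {i} {j} eq with meets (from i) | meets (from j)
    ... | u , u∈ , iu | v , v∈ , jv = begin
      i             ≡⟨ strictlyInverseˡ i ⟨
      to (from i)   ≡⟨ to-cong iu ⟩
      to u          ≡⟨ cong to (trans (lookup-index u∈) (trans (cong (lookup xs) eq) (sym (lookup-index v∈)))) ⟩
      to v          ≡⟨ to-cong jv ⟨
      to (from j)   ≡⟨ strictlyInverseˡ j ⟩
      j             ∎
      where open ≡-Reasoning

-- Counting in filtered lists of pairs

length-filter-map : ∀ {A B : Set} {P : B → Set} (P? : U.Decidable P) (f : A → B) xs →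
                    length (filter P? (map f xs)) ≡ length (filter (P? ∘ f) xs)
length-filter-map P? f []       = refl
length-filter-map P? f (x ∷ xs) with P? (f x)
... | yes _ = cong suc (length-filter-map P? f xs)
... | no  _ = length-filter-map P? f xs

length-filter-cartesianProductWith :
  ∀ {A B C : Set} {P : C → Set} (P? : U.Decidable P) (f : A → B → C) xs ys →
  length (filter P? (cartesianProductWith f xs ys)) ≡ sum (map (λ x → length (filter (P? ∘ f x) ys)) xs)
length-filter-cartesianProductWith P? f []       ys = refl
length-filter-cartesianProductWith P? f (x ∷ xs) ys = begin
  length (filter P? (map (f x) ys ++ zs))                    ≡⟨ cong length (filter-++ P? (map (f x) ys) zs) ⟩
  length (filter P? (map (f x) ys) ++ filter P? zs)          ≡⟨ length-++ (filter P? (map (f x) ys)) ⟩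
  length (filter P? (map (f x) ys)) ℕ.+ length (filter P? zs)
    ≡⟨ cong₂ ℕ._+_ (length-filter-map P? (f x) ys) (length-filter-cartesianProductWith P? f xs ys) ⟩
  length (filter (P? ∘ f x) ys) ℕ.+ _                        ∎
  where
  open ≡-Reasoning
  zs = cartesianProductWith f xs ys

sum-allFin-suc : ∀ {n} (f : Fin (suc n) → ℕ) →
                 sum (map f (allFin (suc n))) ≡ f zero ℕ.+ sum (map (f ∘ suc) (allFin n))
sum-allFin-suc f = cong (λ fs → f zero ℕ.+ sum fs) (trans (map-tabulate suc f) (sym (map-tabulate id (f ∘ suc))))

-- Color classes of a row

module _ {k m : ℕ} where

  Row : Set
  Row = Fin m → Fin k

  -- The column j stands for its color class in the row r.
  First : Row → Fin m → Set
  First r j = ∀ j′ → r j′ ≡ r j → j Fin.≤ j′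

  first? : ∀ r → U.Decidable (First r)
  first? r j = Fin.all? λ j′ → (r j′ Fin.≟ r j) →-dec (j Fin.≤? j′)

  first-unique : ∀ r {i j} → First r i → First r j → r i ≡ r j → i ≡ j
  first-unique r i! j! eq = Fin.≤-antisym (i! _ (sym eq)) (j! _ eq)

  first-of : ∀ r j → ∃ λ j′ → r j′ ≡ r j × First r j′
  first-of r j = go j (<-wellFounded j)
    where
    go : ∀ j → Acc Fin._<_ j → ∃ λ j′ → r j′ ≡ r j × First r j′
    go j (acc smaller) with Fin.any? (λ j′ → (r j′ Fin.≟ r j) ×-dec (j′ Fin.<? j))
    ... | no ¬smaller = j , refl , λ j′ eq → ℕ.≮⇒≥ λ j′<j → ¬smaller (j′ , eq , j′<j)
    ... | yes (i , eq , i<j) with go i (smaller i<j)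
    ...   | j′ , eq′ , first = j′ , trans eq′ eq , first

  Shared : Row → Row → Fin k → Set
  Shared p r a = ∃ λ j → p j ≡ a × r j ≡ a

  shared? : ∀ p r → U.Decidable (Shared p r)
  shared? p r a = Fin.any? λ j → (p j Fin.≟ a) ×-dec (r j Fin.≟ a)

  Fresh : Row → Row → Fin m → Set
  Fresh p r j = First r j × ¬ Shared p r (r j)

  fresh? : ∀ p r → U.Decidable (Fresh p r)
  fresh? p r j = first? r j ×-dec ¬? (shared? p r (r j))

  classes : Row → ℕ
  classes r = length (filter (first? r) (allFin m))

  freshClasses : Row → Row → ℕ
  freshClasses p r = length (filter (fresh? p r) (allFin m))

  -- Rows read off a concatenated word agree with its pieces only pointwise, so the class counts
  -- have to be invariant under `≗`.
  First-resp-≗ : ∀ {r s} → r ≗ s → First r U.⊆ First s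
  First-resp-≗ r≗s first j′ eq = first j′ (trans (r≗s j′) (trans eq (sym (r≗s _))))

  Fresh-resp-≗ : ∀ {p q r s} → p ≗ q → r ≗ s → Fresh p r U.⊆ Fresh q s
  Fresh-resp-≗ p≗q r≗s (first , ¬shared) = First-resp-≗ r≗s first , λ (j , qj , sj) →
    ¬shared (j , trans (p≗q j) (trans qj (sym (r≗s _))) , trans (r≗s j) (trans sj (sym (r≗s _))))

  classes-cong : ∀ {r s} → r ≗ s → classes r ≡ classes s
  classes-cong {r} {s} r≗s = cong length
    (filter-≐ (first? r) (first? s) (First-resp-≗ r≗s , First-resp-≗ (sym ∘ r≗s)) (allFin m))

  freshClasses-cong : ∀ {p q r s} → p ≗ q → r ≗ s → freshClasses p r ≡ freshClasses q s
  freshClasses-cong {p} {q} {r} {s} p≗q r≗s = cong length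
    (filter-≐ (fresh? p r) (fresh? q s)
      (Fresh-resp-≗ p≗q r≗s , Fresh-resp-≗ (sym ∘ p≗q) (sym ∘ r≗s)) (allFin m))

-- Blocks of K m □ P n

module _ {k m n : ℕ} (c : Coloring k (K m □ P n)) where
  open FiniteGraph (monochromatic (K m □ P n) c)

  row : Fin n → Row {k} {m}
  row i j = c (j , i)

  -- Quantifying over a predecessor row `i′` treats all rows alike: in row zero there is none, so
  -- nothing is inherited there.
  Inherited : Fin n → Fin k → Set
  Inherited i a = ∃ λ i′ → toℕ i ≡ suc (toℕ i′) × Shared (row i′) (row i) a

  inherited? : ∀ i → U.Decidable (Inherited i)
  inherited? i a = Fin.any? λ i′ → (toℕ i ℕ.≟ suc (toℕ i′)) ×-dec shared? (row i′) (row i) a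

  -- The canonical vertex of a block: the first column of its lowest class.
  Leader : V → Set
  Leader (j , i) = First (row i) j × ¬ Inherited i (c (j , i))

  leader? : U.Decidable Leader
  leader? (j , i) = first? (row i) j ×-dec ¬? (inherited? i (c (j , i)))

  connected-in-row : ∀ {i j j′} → c (j , i) ≡ c (j′ , i) → Connected (j , i) (j′ , i)
  connected-in-row {j = j} {j′} eq with j Fin.≟ j′
  ... | yes refl = ε
  ... | no  j≢j′ = (inj₂ (refl , j≢j′) , eq) ◅ ε

  -- Descent on the row. While the color is inherited, walk within the row to a shared column and
  -- step down one row; once it is not, move to the first column of the class.
  leader-of : ∀ v → ∃ λ u → Leader u × Connected v u
  leader-of (j , i) = go j i (<-wellFounded i)
    where
    go : ∀ j i → Acc Fin._<_ i → ∃ λ u → Leader u × Connected (j , i) u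
    go j i (acc lower) with inherited? i (c (j , i))
    ... | yes (i′ , i≡1+i′ , j′ , below , here)
      with go j′ i′ (lower (ℕ.≤-reflexive (sym i≡1+i′)))
    ...   | u , leader , path =
      u , leader , connected-in-row (sym here) ◅◅
        (inj₁ (refl , inj₂ i≡1+i′) , trans here (sym below)) ◅ path
    go j i (acc lower) | no ¬inherited with first-of (row i) j
    ...   | j′ , eq , first =
      (j′ , i) , (first , ¬inherited ∘ subst (Inherited i) eq) , connected-in-row (sym eq)

  -- Between the rows of two vertices of one block, every class of their color
  -- is glued to the class below it.
  record Linked (u v : V) : Set where
    field
      same-color : c u ≡ c v
      upward     : ∀ l → proj₂ u Fin.< l → l Fin.≤ proj₂ v → Inherited l (c u)
      downward   : ∀ l → proj₂ v Fin.< l → l Fin.≤ proj₂ u → Inherited l (c u)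

  linked-refl : ∀ {v} → Linked v v
  linked-refl = record
    { same-color = refl
    ; upward     = λ l u<l l≤u → contradiction l≤u (ℕ.<⇒≱ u<l)
    ; downward   = λ l u<l l≤u → contradiction l≤u (ℕ.<⇒≱ u<l)
    }

  -- An edge inside a row leaves both intervals unchanged. A vertical edge shrinks one interval and
  -- may add a single row to the other, namely the upper row of the edge; its inheritance is
  -- witnessed by the column of the edge itself. The intervals depend on the end rows only, so a
  -- walk that turns back needs no extra case.
  linked-step : ∀ {u v w} → Linked u v → v ~ w → Linked u w
  linked-step L (inj₂ (refl , _) , vw) = record { Linked L ; same-color = trans (Linked.same-color L) vw }
  linked-step {u} {j , i} {_ , i′} L (inj₁ (refl , inj₁ i′≡1+i) , vw) = record
    { same-color = trans same-color vw
    ; upward     = λ l u<l l≤i′ → case-≤ l u<l (ℕ.m≤n⇒m<n∨m≡n l≤i′)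
    ; downward   = λ l i′<l → downward l (ℕ.<-trans (ℕ.≤-reflexive (sym i′≡1+i)) i′<l)
    }
    where
    open Linked L
    case-≤ : ∀ l → proj₂ u Fin.< l → l Fin.< i′ ⊎ toℕ l ≡ toℕ i′ → Inherited l (c u)
    case-≤ l u<l (inj₁ l<i′) = upward l u<l (ℕ.s≤s⁻¹ (ℕ.≤-trans l<i′ (ℕ.≤-reflexive i′≡1+i)))
    case-≤ l u<l (inj₂ l≡i′) with refl ← Fin.toℕ-injective l≡i′ =
      i , i′≡1+i , j , sym same-color , sym (trans same-color vw)
  linked-step {u} {j , i} {_ , i′} L (inj₁ (refl , inj₂ i≡1+i′) , vw) = record
    { same-color = trans same-color vw
    ; upward     = λ l u<l l≤i′ → upward l u<l (ℕ.≤-trans l≤i′ (ℕ.<⇒≤ (ℕ.≤-reflexive (sym i≡1+i′))))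
    ; downward   = λ l i′<l l≤u → case-≤ l l≤u (ℕ.m≤n⇒m<n∨m≡n (ℕ.≤-trans (ℕ.≤-reflexive i≡1+i′) i′<l))
    }
    where
    open Linked L
    case-≤ : ∀ l → l Fin.≤ proj₂ u → i Fin.< l ⊎ toℕ i ≡ toℕ l → Inherited l (c u)
    case-≤ l l≤u (inj₁ i<l) = downward l i<l l≤u
    case-≤ l l≤u (inj₂ i≡l) with refl ← Fin.toℕ-injective i≡l =
      i′ , i≡1+i′ , j , sym (trans same-color vw) , sym same-color

  connected⇒linked : ∀ {u v} → Connected u v → Linked u v
  connected⇒linked = go linked-refl
    where
    go : ∀ {u v w} → Linked u v → Connected v w → Linked u w
    go L ε       = L
    go L (e ◅ p) = go (linked-step L e) p

  -- If the rows differ, the linking interval includes the row of the upper leader, whose color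
  -- would then be inherited. In equal rows both are the first column of the same color.
  leader-unique : ∀ {u v} → Leader u → Leader v → Connected u v → u ≡ v
  leader-unique {_ , i} {_ , i′} (u-first , u-lowest) (v-first , v-lowest) path
    with Linked.same-color (connected⇒linked path) | Fin.<-cmp i i′
  ... | eq | tri< i<i′ _ _ =
    contradiction (subst (Inherited i′) eq (Linked.upward (connected⇒linked path) i′ i<i′ ℕ.≤-refl)) v-lowest
  ... | eq | tri> _ _ i>i′ =
    contradiction (Linked.downward (connected⇒linked path) i i>i′ ℕ.≤-refl) u-lowest
  ... | eq | tri≈ _ refl _ = cong (_, i) (first-unique (row i) u-first v-first eq)

  -- Leaders form a transversal of the blocks. Listing the vertices row by row splits their number
  -- into a sum over rows.
  X≡leaders : X k (K m □ P n) c ≡ sum (map (λ i → length (filter (λ j → leader? (j , i)) (allFin m))) (allFin n))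
  X≡leaders = trans
    (numComponents-transversal (monochromatic (K m □ P n) c)
      (Unique.filter⁺ leader? (Unique.cartesianProductWith⁺ vertexAt (λ { refl → refl , refl }) (Unique.allFin⁺ n) (Unique.allFin⁺ m)))
      (λ v → let u , leader , path = leader-of v in u , ∈-leaders leader , path)
      (λ u∈ v∈ → leader-unique (proj₂ (∈-filter⁻ leader? {xs = vertices} u∈)) (proj₂ (∈-filter⁻ leader? {xs = vertices} v∈))))
    (length-filter-cartesianProductWith leader? vertexAt (allFin n) (allFin m))
    where
    vertexAt : Fin n → Fin m → V
    vertexAt i j = j , i
    vertices = cartesianProductWith vertexAt (allFin n) (allFin m)
    ∈-leaders : ∀ {u} → Leader u → u ∈ filter leader? vertices
    ∈-leaders = ∈-filter⁺ leader? (∈-cartesianProductWith⁺ vertexAt (∈-allFin _) (∈-allFin _))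

-- In row zero every class has a leader, and for row `suc i` the only possible predecessor is
-- `inject₁ i`, so `Inherited` becomes `Shared` for two consecutive rows.
X-K□P : ∀ {k m n} (c : Coloring k (K m □ P (suc n))) →
  X k (K m □ P (suc n)) c ≡
    classes (row c zero) ℕ.+ sum (map (λ i → freshClasses (row c (inject₁ i)) (row c (suc i))) (allFin n))
X-K□P {k} {m} {n} c = trans (X≡leaders c) (trans (sum-allFin-suc leaders)
  (cong₂ ℕ._+_
    (cong length (filter-≐ _ _ leaders-zero (allFin m)))
    (cong sum (map-cong (λ i → cong length (filter-≐ _ _ (leaders-suc i) (allFin m))) (allFin n)))))
  where
  leaders : Fin (suc n) → ℕ
  leaders i = length (filter (λ j → leader? c (j , i)) (allFin m))
  leaders-zero : (λ j → Leader c (j , zero)) U.≐ First (row c zero)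
  leaders-zero = proj₁ , λ first → first , λ { (_ , () , _) }
  leaders-suc : ∀ i → (λ j → Leader c (j , suc i)) U.≐ Fresh (row c (inject₁ i)) (row c (suc i))
  leaders-suc i =
    (λ (first , lowest) → first , λ shared →
      lowest (inject₁ i , cong suc (sym (Fin.toℕ-inject₁ i)) , shared)) ,
    (λ (first , ¬shared) → first , λ (i′ , eq , shared) →
      ¬shared (subst (λ l → Shared (row c l) _ _)
        (Fin.toℕ-injective (trans (sym (ℕ.suc-injective eq)) (sym (Fin.toℕ-inject₁ i)))) shared))

-- Sums over words

sum-map-+ : ∀ {A : Set} (f g : A → ℕ) xs →
            sum (map (λ x → f x ℕ.+ g x) xs) ≡ sum (map f xs) ℕ.+ sum (map g xs)
sum-map-+ f g []       = refl
sum-map-+ f g (x ∷ xs) = trans (cong (f x ℕ.+ g x ℕ.+_) (sum-map-+ f g xs))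
  (solve 4 (λ a b s t → (a :+ b) :+ (s :+ t) := (a :+ s) :+ (b :+ t)) refl
    (f x) (g x) (sum (map f xs)) (sum (map g xs)))
  where open +-*-Solver

sum-map-*ˡ : ∀ {A : Set} a (f : A → ℕ) xs → sum (map (λ x → a ℕ.* f x) xs) ≡ a ℕ.* sum (map f xs)
sum-map-*ˡ a f []       = sym (ℕ.*-zeroʳ a)
sum-map-*ˡ a f (x ∷ xs) = trans (cong (a ℕ.* f x ℕ.+_) (sum-map-*ˡ a f xs))
                                (sym (ℕ.*-distribˡ-+ a (f x) (sum (map f xs))))

sum-map-const : ∀ {A : Set} a (xs : List A) → sum (map (λ _ → a) xs) ≡ length xs ℕ.* a
sum-map-const a []       = refl
sum-map-const a (_ ∷ xs) = cong (a ℕ.+_) (sum-map-const a xs)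

sum-map-cong : ∀ {A : Set} {f g : A → ℕ} → f ≗ g → ∀ xs → sum (map f xs) ≡ sum (map g xs)
sum-map-cong f≗g xs = cong sum (map-cong f≗g xs)

sum-cartesianProductWith : ∀ {A B C : Set} (g : C → ℕ) (f : A → B → C) xs ys →
  sum (map g (cartesianProductWith f xs ys)) ≡ sum (map (λ x → sum (map (g ∘ f x) ys)) xs)
sum-cartesianProductWith g f []       ys = refl
sum-cartesianProductWith g f (x ∷ xs) ys = begin
  sum (map g (map (f x) ys ++ zs))               ≡⟨ cong sum (map-++ g (map (f x) ys) zs) ⟩
  sum (map g (map (f x) ys) ++ map g zs)         ≡⟨ sum-++ (map g (map (f x) ys)) (map g zs) ⟩
  sum (map g (map (f x) ys)) ℕ.+ sum (map g zs)
    ≡⟨ cong₂ ℕ._+_ (cong sum (sym (map-∘ ys))) (sum-cartesianProductWith g f xs ys) ⟩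
  sum (map (g ∘ f x) ys) ℕ.+ _                   ∎
  where
  open ≡-Reasoning
  zs = cartesianProductWith f xs ys

∑words : ∀ {k} n → (Vec (Fin k) n → ℕ) → ℕ
∑words {k} n f = sum (map f (words k n))

∑words-++ : ∀ {k} m {n} (f : Vec (Fin k) (m ℕ.+ n) → ℕ) →
            ∑words (m ℕ.+ n) f ≡ ∑words m λ x → ∑words n λ w → f (x Vec.++ w)
∑words-++ zero    f = sym (ℕ.+-identityʳ _)
∑words-++ {k} (suc m) {n} f = begin
  ∑words (suc m ℕ.+ n) f
    ≡⟨ sum-cartesianProductWith f Vec._∷_ (allFin k) (words k (m ℕ.+ n)) ⟩
  sum (map (λ a → ∑words (m ℕ.+ n) (f ∘ (a Vec.∷_))) (allFin k))
    ≡⟨ sum-map-cong (λ a → ∑words-++ m (f ∘ (a Vec.∷_))) (allFin k) ⟩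
  sum (map (λ a → ∑words m λ x → ∑words n λ w → f (a Vec.∷ x Vec.++ w)) (allFin k))
    ≡⟨ sum-cartesianProductWith (λ x → ∑words n λ w → f (x Vec.++ w)) Vec._∷_ (allFin k) (words k m) ⟨
  ∑words (suc m) (λ x → ∑words n λ w → f (x Vec.++ w))  ∎
  where open ≡-Reasoning

∑words-const : ∀ k n a → ∑words {k} n (λ _ → a) ≡ k ℕ.^ n ℕ.* a
∑words-const k zero    a = refl
∑words-const k (suc n) a = begin
  ∑words {k} (suc n) (λ _ → a)
    ≡⟨ sum-cartesianProductWith (λ _ → a) Vec._∷_ (allFin k) (words k n) ⟩
  sum (map (λ _ → ∑words {k} n (λ _ → a)) (allFin k))  ≡⟨ sum-map-const _ (allFin k) ⟩
  length (allFin k) ℕ.* ∑words {k} n (λ _ → a)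
    ≡⟨ cong₂ ℕ._*_ (length-tabulate {n = k} id) (∑words-const k n a) ⟩
  k ℕ.* (k ℕ.^ n ℕ.* a)                                ≡⟨ ℕ.*-assoc k (k ℕ.^ n) a ⟨
  k ℕ.* k ℕ.^ n ℕ.* a                                  ∎
  where open ≡-Reasoning

-- Summing class counts over all colorings, row by row

module _ (k m : ℕ) where

  -- `combine i j` is what the index of the vertex `(j , i)` reduces to in `K m □ P n`, so this is
  -- definitionally a `row` of the coloring encoded by `w`; `sum-X` relies on that.
  wordRow : ∀ {n} → Vec (Fin k) (n ℕ.* m) → Fin n → Row {k} {m}
  wordRow w i j = Vec.lookup w (combine i j)

  wordRow-zero : ∀ {n} (x : Vec (Fin k) m) (w : Vec (Fin k) (n ℕ.* m)) →
                 wordRow {suc n} (x Vec.++ w) zero ≗ Vec.lookup x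
  wordRow-zero x w j = Vec.lookup-++ˡ x w j

  wordRow-suc : ∀ {n} (x : Vec (Fin k) m) (w : Vec (Fin k) (n ℕ.* m)) i →
                wordRow {suc n} (x Vec.++ w) (suc i) ≗ wordRow w i
  wordRow-suc x w i j = Vec.lookup-++ʳ x w (combine i j)

  laterClasses : ∀ n → Vec (Fin k) (suc n ℕ.* m) → ℕ
  laterClasses n w = sum (map (λ i → freshClasses (wordRow {suc n} w (inject₁ i)) (wordRow {suc n} w (suc i))) (allFin n))

  -- Since `inject₁ (suc i)` reduces to `suc (inject₁ i)`, every pair of rows after the first lies
  -- entirely in `w`.
  laterClasses-++ : ∀ n (x : Vec (Fin k) m) (w : Vec (Fin k) (suc n ℕ.* m)) →
    laterClasses (suc n) (x Vec.++ w) ≡ freshClasses (Vec.lookup x) (wordRow {suc n} w zero) ℕ.+ laterClasses n w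
  laterClasses-++ n x w = trans
    (sum-allFin-suc (λ i → freshClasses (wordRow {suc (suc n)} (x Vec.++ w) (inject₁ i)) (wordRow {suc (suc n)} (x Vec.++ w) (suc i))))
    (cong₂ ℕ._+_
      (freshClasses-cong (wordRow-zero {suc n} x w) (wordRow-suc {suc n} x w zero))
      (sum-map-cong (λ i → freshClasses-cong (wordRow-suc {suc n} x w (inject₁ i)) (wordRow-suc {suc n} x w (suc i)))
        (allFin n)))

  ∑classes : ℕ
  ∑classes = ∑words m λ x → classes {k} (Vec.lookup x)

  ∑freshClasses : ℕ
  ∑freshClasses = ∑words m λ x → ∑words m λ y → freshClasses {k} (Vec.lookup x) (Vec.lookup y)

  -- The other `n * m` letters are free, so each first row is counted `k ^ (n * m)` times.
  ∑words-firstRow : ∀ n (f : Row {k} {m} → ℕ) → (∀ {r s} → r ≗ s → f r ≡ f s) →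
    ∑words (suc n ℕ.* m) (λ w → f (wordRow {suc n} w zero)) ≡ k ℕ.^ (n ℕ.* m) ℕ.* ∑words m (f ∘ Vec.lookup)
  ∑words-firstRow n f f-cong = begin
    ∑words (suc n ℕ.* m) (λ w → f (wordRow {suc n} w zero))
      ≡⟨ ∑words-++ m (λ w → f (wordRow {suc n} w zero)) ⟩
    ∑words m (λ x → ∑words (n ℕ.* m) λ w → f (wordRow {suc n} (x Vec.++ w) zero))
      ≡⟨ sum-map-cong (λ x → sum-map-cong (λ w → f-cong (wordRow-zero {n} x w)) (words k (n ℕ.* m))) (words k m) ⟩
    ∑words m (λ x → ∑words (n ℕ.* m) λ _ → f (Vec.lookup x))
      ≡⟨ sum-map-cong (λ x → ∑words-const k (n ℕ.* m) (f (Vec.lookup x))) (words k m) ⟩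
    ∑words m (λ x → k ℕ.^ (n ℕ.* m) ℕ.* f (Vec.lookup x))
      ≡⟨ sum-map-*ˡ (k ℕ.^ (n ℕ.* m)) (f ∘ Vec.lookup) (words k m) ⟩
    k ℕ.^ (n ℕ.* m) ℕ.* ∑words m (f ∘ Vec.lookup)  ∎
    where open ≡-Reasoning

  ∑laterClasses : ℕ → ℕ
  ∑laterClasses n = ∑words (suc n ℕ.* m) (laterClasses n)

  ∑laterClasses-zero : ∑laterClasses 0 ≡ 0
  ∑laterClasses-zero = trans (∑words-const k (1 ℕ.* m) 0) (ℕ.*-zeroʳ (k ℕ.^ (1 ℕ.* m)))

  -- Splits off the lowest row `x`. The first pair of rows leaves `n` rows free; the later pairs do
  -- not involve `x`, which contributes the factor `k ^ m`.
  ∑laterClasses-suc : ∀ n → ∑laterClasses (suc n) ≡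
    k ℕ.^ (n ℕ.* m) ℕ.* ∑freshClasses ℕ.+ k ℕ.^ m ℕ.* ∑laterClasses n
  ∑laterClasses-suc n = begin
    ∑laterClasses (suc n)
      ≡⟨ ∑words-++ m (laterClasses (suc n)) ⟩
    ∑words m (λ x → ∑words (suc n ℕ.* m) λ w → laterClasses (suc n) (x Vec.++ w))
      ≡⟨ sum-map-cong (λ x → sum-map-cong (laterClasses-++ n x) (words k (suc n ℕ.* m))) (words k m) ⟩
    ∑words m (λ x → ∑words (suc n ℕ.* m) λ w → next x w ℕ.+ laterClasses n w)
      ≡⟨ sum-map-cong (λ x → sum-map-+ (next x) (laterClasses n) (words k (suc n ℕ.* m))) (words k m) ⟩
    ∑words m (λ x → ∑words (suc n ℕ.* m) (next x) ℕ.+ ∑laterClasses n)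
      ≡⟨ sum-map-+ (λ x → ∑words (suc n ℕ.* m) (next x)) (λ _ → ∑laterClasses n) (words k m) ⟩
    ∑words m (λ x → ∑words (suc n ℕ.* m) (next x)) ℕ.+ ∑words {k} m (λ _ → ∑laterClasses n)
      ≡⟨ cong₂ ℕ._+_
           (trans
             (sum-map-cong (λ x → ∑words-firstRow n (freshClasses (Vec.lookup x)) (freshClasses-cong (λ _ → refl))) (words k m))
             (sum-map-*ˡ (k ℕ.^ (n ℕ.* m)) _ (words k m)))
           (∑words-const k m (∑laterClasses n)) ⟩
    k ℕ.^ (n ℕ.* m) ℕ.* ∑freshClasses ℕ.+ k ℕ.^ m ℕ.* ∑laterClasses n  ∎
    where
    open ≡-Reasoning
    next : Vec (Fin k) m → Vec (Fin k) (suc n ℕ.* m) → ℕ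
    next x w = freshClasses (Vec.lookup x) (wordRow {suc n} w zero)

  sum-X : ∀ n → sum (map (X k (K m □ P (suc n))) (colorings k (K m □ P (suc n)))) ≡
    k ℕ.^ (n ℕ.* m) ℕ.* ∑classes ℕ.+ ∑laterClasses n
  sum-X n = begin
    sum (map (X k G) (colorings k G))
      ≡⟨ cong sum (map-∘ (words k (suc n ℕ.* m))) ⟨
    ∑words (suc n ℕ.* m) (λ w → X k G (λ v → Vec.lookup w (FiniteGraph.index G v)))
      ≡⟨ sum-map-cong (λ w → X-K□P (λ v → Vec.lookup w (FiniteGraph.index G v))) (words k (suc n ℕ.* m)) ⟩
    ∑words (suc n ℕ.* m) (λ w → classes (wordRow {suc n} w zero) ℕ.+ laterClasses n w)
      ≡⟨ sum-map-+ _ (laterClasses n) (words k (suc n ℕ.* m)) ⟩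
    ∑words (suc n ℕ.* m) (λ w → classes (wordRow {suc n} w zero)) ℕ.+ ∑laterClasses n
      ≡⟨ cong (ℕ._+ ∑laterClasses n) (∑words-firstRow n classes classes-cong) ⟩
    k ℕ.^ (n ℕ.* m) ℕ.* ∑classes ℕ.+ ∑laterClasses n  ∎
    where
    open ≡-Reasoning
    G = K m □ P (suc n)

-- Two colors on K 4 □ P n

-- Evaluated by enumeration. By hand: each of the two colors occurs in `2 ^ 4 - 1` rows.
∑classes₂₄ : ∑classes 2 4 ≡ 30
∑classes₂₄ = refl

-- By hand: for each color, `3 ^ 4` pairs of rows have no column with that color twice, and in
-- `2 ^ 4` of these the upper row misses the color, giving `2 * (81 - 16)`.
∑freshClasses₂₄ : ∑freshClasses 2 4 ≡ 130
∑freshClasses₂₄ = refl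

-- Solves the recurrence with initial value 0; starting at `suc n` keeps the exponent free of
-- subtraction.
∑laterClasses₂₄ : ∀ n → ∑laterClasses 2 4 (suc n) ≡ 130 ℕ.* suc n ℕ.* 2 ℕ.^ (n ℕ.* 4)
∑laterClasses₂₄ zero    = trans (∑laterClasses-suc 2 4 0)
  (cong₂ (λ s t → 1 ℕ.* s ℕ.+ 16 ℕ.* t) ∑freshClasses₂₄ (∑laterClasses-zero 2 4))
∑laterClasses₂₄ (suc n) = trans (∑laterClasses-suc 2 4 (suc n)) (trans
  (cong₂ (λ s t → 2 ℕ.^ (suc n ℕ.* 4) ℕ.* s ℕ.+ 16 ℕ.* t) ∑freshClasses₂₄ (∑laterClasses₂₄ n))
  (solve 2 (λ p n → 16p p :* con 130 :+ con 16 :* (con 130 :* (con 1 :+ n) :* p)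
                 := con 130 :* (con 2 :+ n) :* 16p p) refl
    (2 ℕ.^ (n ℕ.* 4)) n))
  where
  open +-*-Solver
  -- Mirrors how `2 ^ (suc n * 4)` unfolds over `2 ^ (n * 4)`.
  16p : ∀ {v} → Polynomial v → Polynomial v
  16p p = con 2 :* (con 2 :* (con 2 :* (con 2 :* p)))

-- With `2 + n` rows the exponent `4 * (2 + n) - 7` is the natural number `1 + n * 4`; for one row
-- it is negative.
sum-X₂₄ : ∀ n → sum (map (X 2 (K 4 □ P (2 ℕ.+ n))) (colorings 2 (K 4 □ P (2 ℕ.+ n)))) ≡
  2 ℕ.^ (1 ℕ.+ n ℕ.* 4) ℕ.* (175 ℕ.+ 65 ℕ.* (2 ℕ.+ n))
sum-X₂₄ n = trans (sum-X 2 4 (suc n)) (trans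
  (cong₂ (λ s t → 2 ℕ.^ (suc n ℕ.* 4) ℕ.* s ℕ.+ t) ∑classes₂₄ (∑laterClasses₂₄ n))
  (solve 2 (λ p n → con 2 :* (con 2 :* (con 2 :* (con 2 :* p))) :* con 30 :+ con 130 :* (con 1 :+ n) :* p
                 := con 2 :* p :* (con 175 :+ con 65 :* (con 2 :+ n))) refl
    (2 ℕ.^ (n ℕ.* 4)) n))
  where open +-*-Solver

-- Fractions

-- As `fromℚᵘ (mkℚᵘ i d)` unfolds to `i / suc d`, this multiplies fractions that need not be in
-- lowest terms.
fromℚᵘ-homo-* : ∀ p q → ℚ.fromℚᵘ p * ℚ.fromℚᵘ q ≡ ℚ.fromℚᵘ (p ℚᵘ.* q)
fromℚᵘ-homo-* p q = ℚ.toℚᵘ-injective (ℚᵘ.≃-trans (ℚ.toℚᵘ-homo-* (ℚ.fromℚᵘ p) (ℚ.fromℚᵘ q))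
  (ℚᵘ.≃-trans (ℚᵘ.*-cong (ℚ.toℚᵘ-fromℚᵘ p) (ℚ.toℚᵘ-fromℚᵘ q)) (ℚᵘ.≃-sym (ℚ.toℚᵘ-fromℚᵘ (p ℚᵘ.* q)))))

/1-homo-* : ∀ a b → (+ a / 1) * (+ b / 1) ≡ + (a ℕ.* b) / 1
/1-homo-* a b = trans (fromℚᵘ-homo-* (mkℚᵘ (+ a) 0) (mkℚᵘ (+ b) 0)) (cong (_/ 1) (sym (ℤ.pos-* a b)))

-- Replacing `i / 1` by `(i / d) * (+ d / 1)` lets the inverse cancel.
÷-/1 : ∀ i d .{{_ : ℕ.NonZero d}} .{{_ : ℚ.NonZero (+ d / 1)}} → (i / 1) ÷ (+ d / 1) ≡ i / d
÷-/1 i d@(suc d-1) = begin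
  (i / 1) * ℚ.1/ (+ d / 1)                    ≡⟨ cong (_* ℚ.1/ (+ d / 1)) i/d*d ⟨
  ((i / d) * (+ d / 1)) * ℚ.1/ (+ d / 1)      ≡⟨ ℚ.*-assoc (i / d) (+ d / 1) (ℚ.1/ (+ d / 1)) ⟩
  (i / d) * ((+ d / 1) * ℚ.1/ (+ d / 1))      ≡⟨ cong ((i / d) *_) (ℚ.*-inverseʳ (+ d / 1)) ⟩
  (i / d) * ℚ.1ℚ                              ≡⟨ ℚ.*-identityʳ (i / d) ⟩
  i / d                                       ∎
  where
  open ≡-Reasoning
  i/d*d : (i / d) * (+ d / 1) ≡ i / 1
  i/d*d = trans (fromℚᵘ-homo-* (mkℚᵘ i d-1) (mkℚᵘ (+ d) 0))
    (ℚ.fromℚᵘ-cong {mkℚᵘ i d-1 ℚᵘ.* mkℚᵘ (+ d) 0} {mkℚᵘ i 0}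
      (*≡* (trans (ℤ.*-identityʳ (i ℤ.* + d)) (cong (λ e → i ℤ.* + e) (sym (ℕ.*-identityʳ d))))))

corollary6p7 : (n : ℕ) → 1 ≤ n →
    𝔼 2 (K 4 □ P n) (X 2 (K 4 □ P n))
    ≡ _÷_ (2^ (+ (4 ℕ.* n) - + 7) * (+ (175 ℕ.+ 65 ℕ.* n) / 1)) (2^ (+ (4 ℕ.* n))) {{2^-nonZero (+ (4 ℕ.* n))}}
-- Here the power of two is `2^ -3`; both sides are closed and evaluate to 15/8.
corollary6p7 (suc zero)    _ = cong (λ s → + s / 16)
  (trans (sum-X 2 4 0) (cong₂ (λ s t → 1 ℕ.* s ℕ.+ t) ∑classes₂₄ (∑laterClasses-zero 2 4)))
corollary6p7 (suc (suc n)) _ = begin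
  𝔼 2 (K 4 □ P N) (X 2 (K 4 □ P N))
    -- The order of the product graph is `N * 4`, whereas the claim has `4 * N`.
    ≡⟨ ℚ./-cong {{ℕ.m^n≢0 2 (N ℕ.* 4)}} {{ℕ.m^n≢0 2 (4 ℕ.* N)}}
         (cong +_ (sum-X₂₄ n)) (cong (2 ℕ.^_) (ℕ.*-comm N 4)) ⟩
  _/_ (+ (a ℕ.* b)) d {{ℕ.m^n≢0 2 (4 ℕ.* N)}}
    ≡⟨ ÷-/1 (+ (a ℕ.* b)) d {{ℕ.m^n≢0 2 (4 ℕ.* N)}} {{2^-nonZero (+ (4 ℕ.* N))}} ⟨
  _÷_ (+ (a ℕ.* b) / 1) (+ d / 1) {{2^-nonZero (+ (4 ℕ.* N))}}
    ≡⟨ cong (λ p → _÷_ p (+ d / 1) {{2^-nonZero (+ (4 ℕ.* N))}}) (/1-homo-* a b) ⟨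
  _÷_ ((+ a / 1) * (+ b / 1)) (+ d / 1) {{2^-nonZero (+ (4 ℕ.* N))}}
    ≡⟨ cong (λ z → _÷_ (2^ z * (+ b / 1)) (+ d / 1) {{2^-nonZero (+ (4 ℕ.* N))}}) exponent ⟨
  _÷_ (2^ (+ (4 ℕ.* N) - + 7) * (+ b / 1)) (+ d / 1) {{2^-nonZero (+ (4 ℕ.* N))}}  ∎
  where
  open ≡-Reasoning
  N = suc (suc n)
  a = 2 ℕ.^ (1 ℕ.+ n ℕ.* 4)
  b = 175 ℕ.+ 65 ℕ.* N
  d = 2 ℕ.^ (4 ℕ.* N)
  exponent : + (4 ℕ.* N) - + 7 ≡ + (1 ℕ.+ n ℕ.* 4)
  -- `N * 4` exposes eight successors, so subtracting 7 computes.
  exponent = cong (λ e → + e - + 7) (ℕ.*-comm 4 N)
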